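{- No incremental $k$-center algorithm can have approximation ratio $\mathscr{R} < 2$. Explicitly: for every real number $c<2$ there exist a finite nonempty metric space $(S,d)$ with $n=|S|$ points such that for every ordering $c_1,\dots,c_n$ of the points of $S$ there is some $k\in\{1,\dots,n\}$ with $\mathrm{ALG}_k > c\cdot \mathrm{OPT}_k$, where $\mathrm{ALG}_k$ is the $k$-center cost of $\{c_1,\dots,c_k\}$ and $\mathrm{OPT}_k$ is the minimum $k$-center cost over all $k$-element subsets of $S$.
   Context: Discrete $k$-center: the input is a finite set $S$ of $n$ points with a metric $d$. For a nonempty set of centers $C\subseteq S$, its cost is $\mathrm{cost}(C)=\max_{x\in S}\min_{c\in C} d(x,c)$. For $1\le k\le n$, $\mathrm{OPT}_k=\min\{\mathrm{cost}(C): C\subseteq S,\ |C|=k\}$. Incremental $k$-center: an incremental algorithm has full offline access to $(S,d)$ and unlimited computational power, but does not know $k$. It commits to centers one by one, irrevocably, until the process is stopped (at an unknown $k$). Thus on input $(S,d)$ it outputs an ordering $c_1,\dots,c_n$ of the points of $S$, and its solution for $k$ centers is the prefix $\{c_1,\dots,c_k\}$, with cost $\mathrm{ALG}_k=\mathrm{cost}(\{c_1,\dots,c_k\})$. The approximation ratio $\mathscr{R}$ of an incremental algorithm is the worst case (supremum) over all inputs $(S,d)$ of $\max_{1\le k\le n}\mathrm{ALG}_k/\mathrm{OPT}_k$ (for $k=n$ both costs are $0$ and this level imposes no constraint; the ratio is read as $1$). -}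

module Defs where

open import Data.Fin.Base using (Fin; zero; suc; toℕ; fromℕ<)
open import Data.Fin.Permutation using (Permutation′; _⟨$⟩ʳ_; _⟨$⟩ˡ_; inverseˡ)
open import Data.Fin.Properties using (toℕ-fromℕ<)
open import Data.Fin.Subset using (Subset; inside; outside; ⊥; _∈_; ∣_∣; Nonempty)
open import Data.Fin.Subset.Properties using (_∈?_; ∣⊥∣≡0)
open import Data.Integer.Base using (+_)
open import Data.List.Base as List using (List; []; _∷_; _++_; allFin; filter)
open import Data.List.NonEmpty as List⁺ using (List⁺; _∷_)
open import Data.Nat.Base as ℕ using (ℕ; zero; suc; z≤n; s≤s)
import Data.Nat.Properties as ℕ
open import Data.Product.Base using (Σ-syntax; ∃-syntax; _×_; _,_)
open import Data.Rational.Base as ℚ using (ℚ; 0ℚ; 1ℚ; ½)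
import Data.Rational.Properties as ℚ
open import Data.Rational.Solver using (module +-*-Solver)
open import Data.Sum.Base using (inj₁; inj₂)
open import Data.Vec.Base using ([]; _∷_; here; there; tabulate)
open import Data.Vec.Properties using (lookup⇒[]=; lookup∘tabulate)
open import Function.Metric.Definitions using (TriangleInequality)
open import Function.Metric.Structures using (IsSemiMetric)
open import Relation.Binary.Structures using (IsEquivalence; IsPartialOrder)
open import Relation.Binary.PropositionalEquality
  using (_≡_; refl; sym; trans; cong; subst; subst₂)
open import Relation.Nullary.Decidable using (does; dec-true)

------------------------------------------------------------------------
-- Auxiliary facts on the rationals

private
  half-pos : ∀ {ε} → 0ℚ ℚ.< ε → 0ℚ ℚ.< ½ ℚ.* ε
  half-pos {ε} 0<ε =
    subst (ℚ._< ½ ℚ.* ε) (ℚ.*-zeroʳ ½) (ℚ.*-monoʳ-<-pos ½ 0<ε)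

  halves : ∀ ε → ½ ℚ.* ε ℚ.+ ½ ℚ.* ε ≡ ε
  halves ε = trans (sym (ℚ.*-distribʳ-+ ε ½ ½)) (ℚ.*-identityˡ ε)

  p≤∣p∣ : ∀ p → p ℚ.≤ ℚ.∣ p ∣
  p≤∣p∣ p with ℚ.≤-total 0ℚ p
  ... | inj₁ 0≤p = ℚ.≤-reflexive (sym (ℚ.0≤p⇒∣p∣≡p 0≤p))
  ... | inj₂ p≤0 = ℚ.≤-trans p≤0 (ℚ.0≤∣p∣ p)

  ∣-∣-sym : ∀ p q → ℚ.∣ p ℚ.- q ∣ ≡ ℚ.∣ q ℚ.- p ∣
  ∣-∣-sym p q = trans (cong ℚ.∣_∣ eq) (ℚ.∣-p∣≡∣p∣ (q ℚ.- p))
    where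
    open +-*-Solver
    eq : p ℚ.- q ≡ ℚ.- (q ℚ.- p)
    eq = solve 2 (λ p q → p :- q := :- (q :- p)) refl p q

  close⇒< : ∀ {p q ε} → ℚ.∣ p ℚ.- q ∣ ℚ.< ε → p ℚ.< q ℚ.+ ε
  close⇒< {p} {q} {ε} lt =
    subst (ℚ._< q ℚ.+ ε) eq
      (ℚ.+-monoʳ-< q (ℚ.≤-<-trans (p≤∣p∣ (p ℚ.- q)) lt))
    where
    open +-*-Solver
    eq : q ℚ.+ (p ℚ.- q) ≡ p
    eq = solve 2 (λ p q → q :+ (p :- q) := p) refl p q

  <⇒-< : ∀ {p q ε} → p ℚ.< q ℚ.+ ε → p ℚ.- q ℚ.< ε
  <⇒-< {p} {q} {ε} lt =
    subst (p ℚ.- q ℚ.<_) eq (ℚ.+-monoˡ-< (ℚ.- q) lt)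
    where
    open +-*-Solver
    eq : q ℚ.+ ε ℚ.- q ≡ ε
    eq = solve 2 (λ q ε → q :+ ε :- q := ε) refl q ε

  <⇒close : ∀ {p q ε} → p ℚ.< q ℚ.+ ε → q ℚ.< p ℚ.+ ε → ℚ.∣ p ℚ.- q ∣ ℚ.< ε
  <⇒close {p} {q} {ε} p<q+ε q<p+ε with ℚ.∣p∣≡p∨∣p∣≡-p (p ℚ.- q)
  ... | inj₁ eq = subst (ℚ._< ε) (sym eq) (<⇒-< p<q+ε)
  ... | inj₂ eq = subst (ℚ._< ε) (sym (trans eq eq′)) (<⇒-< q<p+ε)
    where
    open +-*-Solver
    eq′ : ℚ.- (p ℚ.- q) ≡ q ℚ.- p
    eq′ = solve 2 (λ p q → :- (p :- q) := q :- p) refl p q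

  NonExpansive : (ℚ → ℚ → ℚ) → Set
  NonExpansive _∙_ = ∀ a a′ b b′ {δ} → 0ℚ ℚ.< δ →
    a ℚ.< a′ ℚ.+ δ → b ℚ.< b′ ℚ.+ δ → (a ∙ b) ℚ.< (a′ ∙ b′) ℚ.+ (δ ℚ.+ δ)

  +-nonExpansive : NonExpansive ℚ._+_
  +-nonExpansive a a′ b b′ {δ} _ a< b< =
    subst (a ℚ.+ b ℚ.<_) eq (ℚ.+-mono-< a< b<)
    where
    open +-*-Solver
    eq : (a′ ℚ.+ δ) ℚ.+ (b′ ℚ.+ δ) ≡ (a′ ℚ.+ b′) ℚ.+ (δ ℚ.+ δ)
    eq = solve 3 (λ a b δ → (a :+ δ) :+ (b :+ δ) := (a :+ b) :+ (δ :+ δ)) refl a′ b′ δ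

  widen : ∀ {p q r δ} → 0ℚ ℚ.< δ → q ℚ.≤ r → p ℚ.< q ℚ.+ δ → p ℚ.< r ℚ.+ (δ ℚ.+ δ)
  widen {p} {q} {r} {δ} 0<δ q≤r p< =
    ℚ.<-≤-trans p< (ℚ.+-mono-≤ q≤r
      (subst (ℚ._≤ δ ℚ.+ δ) (ℚ.+-identityʳ δ) (ℚ.+-monoʳ-≤ δ (ℚ.<⇒≤ 0<δ))))

  ⊔-nonExpansive : NonExpansive ℚ._⊔_
  ⊔-nonExpansive a a′ b b′ 0<δ a< b< with ℚ.⊔-sel a b
  ... | inj₁ eq = subst (ℚ._< _) (sym eq) (widen 0<δ (ℚ.p≤p⊔q a′ b′) a<)
  ... | inj₂ eq = subst (ℚ._< _) (sym eq) (widen 0<δ (ℚ.p≤q⊔p a′ b′) b<)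

  ⊓-nonExpansive : NonExpansive ℚ._⊓_
  ⊓-nonExpansive a a′ b b′ 0<δ a< b< with ℚ.⊓-sel a′ b′
  ... | inj₁ eq = ℚ.≤-<-trans (ℚ.p⊓q≤p a b) (widen 0<δ (ℚ.≤-reflexive (sym eq)) a<)
  ... | inj₂ eq = ℚ.≤-<-trans (ℚ.p⊓q≤q a b) (widen 0<δ (ℚ.≤-reflexive (sym eq)) b<)

------------------------------------------------------------------------
-- Real numbers: Cauchy sequences of rationals, taken up to _≈_

Cauchy : (ℕ → ℚ) → Set
Cauchy s = ∀ ε → 0ℚ ℚ.< ε →
  ∃[ N ] (∀ m n → N ℕ.≤ m → N ℕ.≤ n → ℚ.∣ s m ℚ.- s n ∣ ℚ.< ε)

record ℝ : Set where
  constructor mkℝ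
  field
    seq    : ℕ → ℚ
    cauchy : Cauchy seq

open ℝ public

infix 4 _≈_ _≤_ _<_

_≈_ : ℝ → ℝ → Set
x ≈ y = ∀ ε → 0ℚ ℚ.< ε →
  ∃[ N ] (∀ n → N ℕ.≤ n → ℚ.∣ seq x n ℚ.- seq y n ∣ ℚ.< ε)

_≤_ : ℝ → ℝ → Set
x ≤ y = ∀ ε → 0ℚ ℚ.< ε →
  ∃[ N ] (∀ n → N ℕ.≤ n → seq x n ℚ.< seq y n ℚ.+ ε)

_<_ : ℝ → ℝ → Set
x < y = ∃[ ε ] (0ℚ ℚ.< ε ×
  ∃[ N ] (∀ n → N ℕ.≤ n → seq x n ℚ.+ ε ℚ.≤ seq y n))

abstract
  const-cauchy : ∀ q → Cauchy (λ _ → q)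
  const-cauchy q ε 0<ε = 0 , λ _ _ _ _ →
    subst (ℚ._< ε) (sym (cong ℚ.∣_∣ (ℚ.+-inverseʳ q))) 0<ε

fromℚ : ℚ → ℝ
fromℚ q = mkℝ (λ _ → q) (const-cauchy q)

0ℝ 2ℝ : ℝ
0ℝ = fromℚ 0ℚ
2ℝ = fromℚ (+ 2 ℚ./ 1)

abstract
  lift₂-cauchy : ∀ _∙_ → NonExpansive _∙_ → ∀ x y → Cauchy (λ n → seq x n ∙ seq y n)
  lift₂-cauchy _∙_ nonExp x y ε 0<ε
    with cauchy x (½ ℚ.* ε) (half-pos 0<ε) | cauchy y (½ ℚ.* ε) (half-pos 0<ε)
  ... | Nx , hx | Ny , hy = Nx ℕ.⊔ Ny , λ m n N≤m N≤n →
        <⇒close (step m n N≤m N≤n) (step n m N≤n N≤m)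
      where
      step : ∀ m n → Nx ℕ.⊔ Ny ℕ.≤ m → Nx ℕ.⊔ Ny ℕ.≤ n →
        (seq x m ∙ seq y m) ℚ.< (seq x n ∙ seq y n) ℚ.+ ε
      step m n N≤m N≤n =
        subst (λ e → (seq x m ∙ seq y m) ℚ.< (seq x n ∙ seq y n) ℚ.+ e) (halves ε)
          (nonExp (seq x m) (seq x n) (seq y m) (seq y n) (half-pos 0<ε)
            (close⇒< (hx m n (ℕ.m⊔n≤o⇒m≤o Nx Ny N≤m) (ℕ.m⊔n≤o⇒m≤o Nx Ny N≤n)))
            (close⇒< (hy m n (ℕ.m⊔n≤o⇒n≤o Nx Ny N≤m) (ℕ.m⊔n≤o⇒n≤o Nx Ny N≤n))))

infixl 7 _*_ _⊓_
infixl 6 _+_ _⊔_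

_+_ _⊔_ _⊓_ : ℝ → ℝ → ℝ
x + y = mkℝ (λ n → seq x n ℚ.+ seq y n) (lift₂-cauchy ℚ._+_ +-nonExpansive x y)
x ⊔ y = mkℝ (λ n → seq x n ℚ.⊔ seq y n) (lift₂-cauchy ℚ._⊔_ ⊔-nonExpansive x y)
x ⊓ y = mkℝ (λ n → seq x n ℚ.⊓ seq y n) (lift₂-cauchy ℚ._⊓_ ⊓-nonExpansive x y)

private
  EventuallyBounded : (ℕ → ℚ) → Set
  EventuallyBounded s = ∃[ B ] (ℚ.Positive B ×
    ∃[ N ] (∀ n → N ℕ.≤ n → ℚ.∣ s n ∣ ℚ.≤ B))

  eventuallyBounded : ∀ x → EventuallyBounded (seq x)
  eventuallyBounded x with cauchy x 1ℚ (ℚ.positive⁻¹ 1ℚ)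
  ... | N , h = ℚ.∣ seq x N ∣ ℚ.+ 1ℚ , pos , N , bound
    where
    pos : ℚ.Positive (ℚ.∣ seq x N ∣ ℚ.+ 1ℚ)
    pos = ℚ.nonNeg+pos⇒pos ℚ.∣ seq x N ∣ {{ℚ.∣-∣-nonNeg (seq x N)}} 1ℚ

    bound : ∀ n → N ℕ.≤ n → ℚ.∣ seq x n ∣ ℚ.≤ ℚ.∣ seq x N ∣ ℚ.+ 1ℚ
    bound n N≤n = subst (λ p → ℚ.∣ p ∣ ℚ.≤ ℚ.∣ seq x N ∣ ℚ.+ 1ℚ) eq
      (ℚ.≤-trans (ℚ.∣p+q∣≤∣p∣+∣q∣ (seq x N) (seq x n ℚ.- seq x N))
        (ℚ.+-monoʳ-≤ ℚ.∣ seq x N ∣ (ℚ.<⇒≤ (h n N N≤n ℕ.≤-refl))))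
      where
      open +-*-Solver
      eq : seq x N ℚ.+ (seq x n ℚ.- seq x N) ≡ seq x n
      eq = solve 2 (λ a b → a :+ (b :- a) := b) refl (seq x N) (seq x n)

  shrink : ∀ B → .{{ℚ.Positive B}} → ∀ {ε} → 0ℚ ℚ.< ε → ∃[ δ ] (0ℚ ℚ.< δ × B ℚ.* δ ≡ ε)
  shrink B {ε} 0<ε = ℚ.1/ B ℚ.* ε , ℚ.positive⁻¹ (ℚ.1/ B ℚ.* ε) {{δ-pos}} ,
    trans (sym (ℚ.*-assoc B (ℚ.1/ B) ε))
      (trans (cong (ℚ._* ε) (ℚ.*-inverseʳ B)) (ℚ.*-identityˡ ε))
    where
    instance
      B≢0 : ℚ.NonZero B
      B≢0 = ℚ.pos⇒nonZero B
    δ-pos : ℚ.Positive (ℚ.1/ B ℚ.* ε)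
    δ-pos = ℚ.pos*pos⇒pos (ℚ.1/ B) {{ℚ.1/pos⇒pos B}} ε {{ℚ.positive 0<ε}}

  small : ∀ B → .{{ℚ.Positive B}} → ∀ {δ ε s t} → B ℚ.* δ ≡ ε →
    ℚ.∣ s ∣ ℚ.≤ B → ℚ.∣ t ∣ ℚ.< δ → ℚ.∣ s ℚ.* t ∣ ℚ.< ε
  small B {δ} {ε} {s} {t} Bδ≡ε s≤B t<δ =
    subst₂ ℚ._<_ (sym (ℚ.∣p*q∣≡∣p∣*∣q∣ s t)) Bδ≡ε
      (ℚ.≤-<-trans (ℚ.*-monoʳ-≤-nonNeg ℚ.∣ t ∣ {{ℚ.∣-∣-nonNeg t}} s≤B)
        (ℚ.*-monoʳ-<-pos B t<δ))

  split : ∀ a a′ b b′ →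
    a ℚ.* (b ℚ.- b′) ℚ.+ b′ ℚ.* (a ℚ.- a′) ≡ a ℚ.* b ℚ.- a′ ℚ.* b′
  split = solve 4
    (λ a a′ b b′ → a :* (b :- b′) :+ b′ :* (a :- a′) := a :* b :- a′ :* b′) refl
    where open +-*-Solver

  *-close : ∀ a a′ b b′ {ε} →
    ℚ.∣ a ℚ.* (b ℚ.- b′) ∣ ℚ.< ½ ℚ.* ε → ℚ.∣ b′ ℚ.* (a ℚ.- a′) ∣ ℚ.< ½ ℚ.* ε →
    ℚ.∣ a ℚ.* b ℚ.- a′ ℚ.* b′ ∣ ℚ.< ε
  *-close a a′ b b′ {ε} s< t< =
    subst₂ ℚ._<_ (cong ℚ.∣_∣ (split a a′ b b′)) (halves ε)
      (ℚ.≤-<-trans (ℚ.∣p+q∣≤∣p∣+∣q∣ (a ℚ.* (b ℚ.- b′)) (b′ ℚ.* (a ℚ.- a′)))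
        (ℚ.+-mono-< s< t<))

  *-cauchy′ : ∀ (s t : ℕ → ℚ) ε A B .{{_ : ℚ.Positive A}} .{{_ : ℚ.Positive B}} →
    ∃[ N ] (∀ n → N ℕ.≤ n → ℚ.∣ s n ∣ ℚ.≤ A) →
    ∃[ N ] (∀ n → N ℕ.≤ n → ℚ.∣ t n ∣ ℚ.≤ B) →
    ∀ {γ δ} → A ℚ.* γ ≡ ½ ℚ.* ε → B ℚ.* δ ≡ ½ ℚ.* ε →
    ∃[ N ] (∀ m n → N ℕ.≤ m → N ℕ.≤ n → ℚ.∣ s m ℚ.- s n ∣ ℚ.< δ) →
    ∃[ N ] (∀ m n → N ℕ.≤ m → N ℕ.≤ n → ℚ.∣ t m ℚ.- t n ∣ ℚ.< γ) →
    ∃[ N ] (∀ m n → N ℕ.≤ m → N ℕ.≤ n → ℚ.∣ s m ℚ.* t m ℚ.- s n ℚ.* t n ∣ ℚ.< ε)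
  *-cauchy′ s t ε A B (M₁ , a) (M₂ , b) {γ} {δ} Aγ Bδ (N₁ , c) (N₂ , d) =
    (M₁ ℕ.⊔ M₂) ℕ.⊔ (N₁ ℕ.⊔ N₂) , λ m n ≤m ≤n →
      *-close (s m) (s n) (t m) (t n) {ε}
        (small A {γ} {½ ℚ.* ε} {s m} {t m ℚ.- t n} Aγ
          (a m (M₁≤ ≤m)) (d m n (N₂≤ ≤m) (N₂≤ ≤n)))
        (small B {δ} {½ ℚ.* ε} {t n} {s m ℚ.- s n} Bδ
          (b n (M₂≤ ≤n)) (c m n (N₁≤ ≤m) (N₁≤ ≤n)))
    where
    M₁≤ : ∀ {k} → (M₁ ℕ.⊔ M₂) ℕ.⊔ (N₁ ℕ.⊔ N₂) ℕ.≤ k → M₁ ℕ.≤ k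
    M₁≤ h = ℕ.m⊔n≤o⇒m≤o M₁ M₂ (ℕ.m⊔n≤o⇒m≤o (M₁ ℕ.⊔ M₂) (N₁ ℕ.⊔ N₂) h)
    M₂≤ : ∀ {k} → (M₁ ℕ.⊔ M₂) ℕ.⊔ (N₁ ℕ.⊔ N₂) ℕ.≤ k → M₂ ℕ.≤ k
    M₂≤ h = ℕ.m⊔n≤o⇒n≤o M₁ M₂ (ℕ.m⊔n≤o⇒m≤o (M₁ ℕ.⊔ M₂) (N₁ ℕ.⊔ N₂) h)
    N₁≤ : ∀ {k} → (M₁ ℕ.⊔ M₂) ℕ.⊔ (N₁ ℕ.⊔ N₂) ℕ.≤ k → N₁ ℕ.≤ k
    N₁≤ h = ℕ.m⊔n≤o⇒m≤o N₁ N₂ (ℕ.m⊔n≤o⇒n≤o (M₁ ℕ.⊔ M₂) (N₁ ℕ.⊔ N₂) h)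
    N₂≤ : ∀ {k} → (M₁ ℕ.⊔ M₂) ℕ.⊔ (N₁ ℕ.⊔ N₂) ℕ.≤ k → N₂ ℕ.≤ k
    N₂≤ h = ℕ.m⊔n≤o⇒n≤o N₁ N₂ (ℕ.m⊔n≤o⇒n≤o (M₁ ℕ.⊔ M₂) (N₁ ℕ.⊔ N₂) h)

abstract
  *-cauchy : ∀ x y → Cauchy (λ n → seq x n ℚ.* seq y n)
  *-cauchy x y ε 0<ε = bounded (eventuallyBounded x) (eventuallyBounded y)
    where
    Goal : Set
    Goal = ∃[ N ] (∀ m n → N ℕ.≤ m → N ℕ.≤ n →
      ℚ.∣ seq x m ℚ.* seq y m ℚ.- seq x n ℚ.* seq y n ∣ ℚ.< ε)

    bounded : EventuallyBounded (seq x) → EventuallyBounded (seq y) → Goal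
    bounded (A , A>0 , a) (B , B>0 , b) =
      shrunk (shrink A {{A>0}} (half-pos 0<ε)) (shrink B {{B>0}} (half-pos 0<ε))
      where
      shrunk : ∃[ γ ] (0ℚ ℚ.< γ × A ℚ.* γ ≡ ½ ℚ.* ε) →
               ∃[ δ ] (0ℚ ℚ.< δ × B ℚ.* δ ≡ ½ ℚ.* ε) → Goal
      shrunk (γ , 0<γ , Aγ) (δ , 0<δ , Bδ) =
        *-cauchy′ (seq x) (seq y) ε A B {{A>0}} {{B>0}} a b {γ} {δ} Aγ Bδ
          (cauchy x δ 0<δ) (cauchy y γ 0<γ)

_*_ : ℝ → ℝ → ℝ
x * y = mkℝ (λ n → seq x n ℚ.* seq y n) (*-cauchy x y)

≈⇒≤ : ∀ {x y} → x ≈ y → x ≤ y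
≈⇒≤ x≈y ε 0<ε with x≈y ε 0<ε
... | N , h = N , λ n N≤n → close⇒< (h n N≤n)

≤-trans : ∀ {x y z} → x ≤ y → y ≤ z → x ≤ z
≤-trans {x} {y} {z} x≤y y≤z ε 0<ε
  with x≤y (½ ℚ.* ε) (half-pos 0<ε) | y≤z (½ ℚ.* ε) (half-pos 0<ε)
... | M , h | N , k = M ℕ.⊔ N , λ n ≤n →
  subst (seq x n ℚ.<_)
    (trans (ℚ.+-assoc (seq z n) (½ ℚ.* ε) (½ ℚ.* ε)) (cong (seq z n ℚ.+_) (halves ε)))
    (ℚ.<-trans (h n (ℕ.m⊔n≤o⇒m≤o M N ≤n))
      (ℚ.+-monoˡ-< (½ ℚ.* ε) (k n (ℕ.m⊔n≤o⇒n≤o M N ≤n))))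

≤-antisym : ∀ {x y} → x ≤ y → y ≤ x → x ≈ y
≤-antisym x≤y y≤x ε 0<ε with x≤y ε 0<ε | y≤x ε 0<ε
... | M , h | N , k = M ℕ.⊔ N , λ n ≤n →
  <⇒close (h n (ℕ.m⊔n≤o⇒m≤o M N ≤n)) (k n (ℕ.m⊔n≤o⇒n≤o M N ≤n))

≈-refl : ∀ {x} → x ≈ x
≈-refl {x} ε 0<ε = 0 , λ n _ →
  subst (ℚ._< ε) (sym (cong ℚ.∣_∣ (ℚ.+-inverseʳ (seq x n)))) 0<ε

≈-sym : ∀ {x y} → x ≈ y → y ≈ x
≈-sym {x} {y} x≈y ε 0<ε with x≈y ε 0<ε
... | N , h = N , λ n N≤n → subst (ℚ._< ε) (∣-∣-sym (seq x n) (seq y n)) (h n N≤n)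

≈-isEquivalence : IsEquivalence _≈_
≈-isEquivalence = record
  { refl  = λ {x} → ≈-refl {x}
  ; sym   = λ {x} {y} → ≈-sym {x} {y}
  ; trans = λ {x} {y} {z} x≈y y≈z → ≤-antisym {x} {z}
      (≤-trans {x} {y} {z} (≈⇒≤ {x} {y} x≈y) (≈⇒≤ {y} {z} y≈z))
      (≤-trans {z} {y} {x} (≈⇒≤ {z} {y} (≈-sym {y} {z} y≈z))
                           (≈⇒≤ {y} {x} (≈-sym {x} {y} x≈y)))
  }

≤-isPartialOrder : IsPartialOrder _≈_ _≤_
≤-isPartialOrder = record
  { isPreorder = record
    { isEquivalence = ≈-isEquivalence
    ; reflexive     = λ {x} {y} → ≈⇒≤ {x} {y}
    ; trans         = λ {x} {y} {z} → ≤-trans {x} {y} {z}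
    }
  ; antisym = λ {x} {y} → ≤-antisym {x} {y}
  }

maximum minimum : List⁺ ℝ → ℝ
maximum = List⁺.foldr₁ _⊔_
minimum = List⁺.foldr₁ _⊓_

------------------------------------------------------------------------
-- Discrete k-center

-- The last two fields are those of `IsGeneralMetric`; with that record
-- as a single field the positivity check does not finish.
record FiniteMetricSpace : Set where
  field
    size             : ℕ
    {{size-nonZero}} : ℕ.NonZero size
    d                : Fin size → Fin size → ℝ
    isSemiMetric     : IsSemiMetric _≡_ _≈_ _≤_ 0ℝ d
    triangle         : TriangleInequality _≤_ _+_ d

open FiniteMetricSpace public using (size; d)

elements : ∀ {n} → Subset n → List (Fin n)
elements {n} C = filter (_∈? C) (allFin n)

-- The witness w of nonemptiness is put in front of both lists only to
-- make them visibly nonempty: w already belongs to C and to S, so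
-- repeating it changes neither the minimum nor the maximum.
cost : ∀ M (C : Subset (size M)) → Nonempty C → ℝ
cost M C (w , _) =
  maximum (List⁺.map (λ x → minimum (List⁺.map (d M x) (w ∷ elements C)))
                     (w ∷ allFin (size M)))

-- Every k-element subset of Fin n occurs exactly once.
subsets : ∀ n k → List (Σ[ C ∈ Subset n ] ∣ C ∣ ≡ k)
subsets zero    zero    = ([] , refl) ∷ []
subsets zero    (suc k) = []
subsets (suc n) zero    = List.map (λ (C , eq) → outside ∷ C , eq) (subsets n zero)
subsets (suc n) (suc k) =
  List.map (λ (C , eq) → inside ∷ C , cong suc eq) (subsets n k) ++
  List.map (λ (C , eq) → outside ∷ C , eq) (subsets n (suc k))

firstSubset : ∀ {n k} → k ℕ.≤ n → Σ[ C ∈ Subset n ] ∣ C ∣ ≡ k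
firstSubset {n} z≤n = ⊥ , ∣⊥∣≡0 n
firstSubset (s≤s k≤n) with firstSubset k≤n
... | C , eq = inside ∷ C , cong suc eq

nonempty : ∀ {n k} (C : Subset n) → ∣ C ∣ ≡ k → 1 ℕ.≤ k → Nonempty C
nonempty []            refl ()
nonempty (inside  ∷ C) _    _   = zero , here
nonempty (outside ∷ C) eq   1≤k with nonempty C eq 1≤k
... | i , i∈C = suc i , there i∈C

-- As in `cost`, the head of the list is a redundant entry.
OPT : ∀ M k → 1 ℕ.≤ k → k ℕ.≤ size M → ℝ
OPT M k 1≤k k≤n =
  minimum (List⁺.map (λ (C , ∣C∣≡k) → cost M C (nonempty C ∣C∣≡k 1≤k))
                     (firstSubset k≤n ∷ subsets (size M) k))

------------------------------------------------------------------------
-- Incremental k-center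

-- An ordering σ opens the point σ ⟨$⟩ʳ i as its (i+1)-st center, so x is
-- among the first k centers iff its position σ ⟨$⟩ˡ x is below k.
prefix : ∀ {n} → Permutation′ n → ℕ → Subset n
prefix σ k = tabulate (λ x → does (toℕ (σ ⟨$⟩ˡ x) ℕ.<? k))

∈-prefix : ∀ {n} (σ : Permutation′ n) k i → toℕ i ℕ.< k → σ ⟨$⟩ʳ i ∈ prefix σ k
∈-prefix σ k i i<k = lookup⇒[]= (σ ⟨$⟩ʳ i) (prefix σ k)
  (trans (lookup∘tabulate _ (σ ⟨$⟩ʳ i))
    (dec-true (toℕ (σ ⟨$⟩ˡ (σ ⟨$⟩ʳ i)) ℕ.<? k)
      (subst (λ j → toℕ j ℕ.< k) (sym (inverseˡ σ)) i<k)))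

prefix-nonempty : ∀ {n} (σ : Permutation′ n) k → 1 ℕ.≤ k → k ℕ.≤ n → Nonempty (prefix σ k)
prefix-nonempty σ k 1≤k k≤n = σ ⟨$⟩ʳ first , ∈-prefix σ k first
  (subst (ℕ._< k) (sym (toℕ-fromℕ< 0<n)) 1≤k)
  where
  0<n   = ℕ.≤-trans 1≤k k≤n
  first = fromℕ< 0<n

ALG : ∀ M → Permutation′ (size M) → ∀ k → 1 ℕ.≤ k → k ℕ.≤ size M → ℝ
ALG M σ k 1≤k k≤n = cost M (prefix σ k) (prefix-nonempty σ k 1≤k k≤n)

IncrementalAlgorithm : Set
IncrementalAlgorithm = (M : FiniteMetricSpace) → Permutation′ (size M)

-- The supremum of ALG_k / OPT_k over all inputs and all k is at most c.
-- In product form the level k = n, where both costs vanish, imposes no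
-- constraint.
RatioAtMost : IncrementalAlgorithm → ℝ → Set
RatioAtMost A c = ∀ M k (1≤k : 1 ℕ.≤ k) (k≤n : k ℕ.≤ size M) →
  ALG M (A M) k 1≤k k≤n ≤ c * OPT M k 1≤k k≤n

{-# OPTIONS --safe #-}

-- On the line take S = {0, 1, 2, 4, …, 2^N}. Whichever point is opened
-- first is bad at some level. If it is 2^j with j ≥ 1, consider
-- k = N − j + 1: the k centers 2^N, …, 2^(j+1), 2^(j−1) have cost
-- 2^(j−1), whereas k centers including 2^j either omit some 2^l with
-- l > j, or are exactly 2^N, …, 2^j and leave 0 at distance 2^j. If the
-- first point is 0 or 1, then k = 1 already gives 2^N − 1 against 2^(N−1).
module Submission where

open import Defs
open import Data.Bool.Properties using (T-≡)
open import Data.Fin.Base using (Fin; zero; suc; toℕ; fromℕ; fromℕ<; inject≤)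
import Data.Fin.Properties as Fin
open import Data.Fin.Permutation
  using (Permutation′; _⟨$⟩ʳ_; _⟨$⟩ˡ_; inverseʳ)
open import Data.Fin.Subset using (Subset; inside; outside; ∣_∣; _∈_; ⊥; Nonempty)
open import Data.Fin.Subset.Properties using (_∈?_; ∣⊥∣≡0)
open import Data.Integer.Base as ℤ using (+_; +≤+; +<+)
import Data.Integer.Properties as ℤ
open import Data.List.Base using ([]; _∷_; allFin)
open import Data.List.Membership.Propositional renaming (_∈_ to _∈ₗ_) using ()
open import Data.List.Membership.Propositional.Properties
  using (∈-allFin; ∈-filter⁺; ∈-filter⁻; ∈-map⁺; ∈-++⁺ˡ; ∈-++⁺ʳ)
open import Data.List.NonEmpty as List⁺ using (_∷_)
open import Data.List.Relation.Unary.Any using (here; there)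
open import Data.Nat.Base as ℕ using (ℕ; zero; suc; z≤n; s≤s)
import Data.Nat.Properties as ℕ
open import Data.Product.Base using (Σ-syntax; ∃-syntax; _×_; _,_; proj₁; proj₂)
open import Data.Rational.Base as ℚ using (ℚ; mkℚ; 0ℚ; 1ℚ; *≤*; *<*)
open import Data.Rational.Literals using (fromℤ)
import Data.Rational.Properties as ℚ
open import Data.Rational.Solver using (module +-*-Solver)
open import Data.Rational.Unnormalised.Base as ℚᵘ using (*≡*)
import Data.Rational.Unnormalised.Properties as ℚᵘ
open import Data.Sum.Base using (_⊎_; inj₁; inj₂)
open import Data.Vec.Base using ([]; _∷_; here; there)
open import Data.Vec.Properties using ([]=⇒lookup; lookup∘tabulate)
open import Function.Bundles using (Equivalence)
open import Function.Definitions using (Injective)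
open import Relation.Binary.Definitions using (tri<; tri≈; tri>)
open import Relation.Binary.PropositionalEquality
  using (_≡_; _≢_; refl; sym; trans; cong; cong₂; subst; subst₂; isEquivalence)
open import Relation.Nullary.Decidable using (yes; no; ¬?; _×-dec_)
open import Relation.Nullary.Negation using (¬_; contradiction)

-- Naturals as rationals

ι : ℕ → ℚ
ι n = fromℤ (+ n)

ι-mono : ∀ {m n} → m ℕ.≤ n → ι m ℚ.≤ ι n
ι-mono {m} {n} m≤n = *≤* (subst₂ ℤ._≤_
  (sym (ℤ.*-identityʳ (+ m))) (sym (ℤ.*-identityʳ (+ n))) (+≤+ m≤n))

ι-cancel-< : ∀ {m n} → ι m ℚ.< ι n → m ℕ.< n
ι-cancel-< {m} {n} (*<* lt) = ℤ.drop‿+<+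
  (subst₂ ℤ._<_ (ℤ.*-identityʳ (+ m)) (ℤ.*-identityʳ (+ n)) lt)

ι-+ : ∀ m n → ι (m ℕ.+ n) ≡ ι m ℚ.+ ι n
ι-+ m n = ℚ.toℚᵘ-injective (ℚᵘ.≃-trans
  (*≡* (cong (ℤ._* + 1) (sym (cong₂ ℤ._+_ (ℤ.*-identityʳ (+ m)) (ℤ.*-identityʳ (+ n))))))
  (ℚᵘ.≃-sym (ℚ.toℚᵘ-homo-+ (ι m) (ι n))))

n<2^n : ∀ n → n ℕ.< 2 ℕ.^ n
n<2^n zero    = s≤s z≤n
n<2^n (suc n) = ℕ.≤-trans (ℕ.+-mono-≤ (ℕ.m^n>0 2 n) (n<2^n n))
  (ℕ.+-monoʳ-≤ (2 ℕ.^ n) (ℕ.m≤m+n (2 ℕ.^ n) 0))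

-- If ε = p/q in lowest terms with p ≥ 1, then K = q suffices, because 2^q > q. This later absorbs
-- the additive loss of 1 when the first center is 0 or 1.
2^-archimedean : ∀ {ε} → 0ℚ ℚ.< ε → ∃[ K ] (1ℚ ℚ.< ε ℚ.* ι (2 ℕ.^ K))
2^-archimedean {mkℚ (+ zero)     b _} (*<* (+<+ ()))
2^-archimedean {ε@(mkℚ (+ suc a) b _)} _ = suc b , ℚ.toℚᵘ-cancel-<
  (ℚᵘ.<-respʳ-≃ (ℚᵘ.≃-sym (ℚ.toℚᵘ-homo-* ε (ι n)))
    (ℚᵘ.*<* (subst₂ ℤ._<_ lhs rhs (+<+ (ℕ.<-≤-trans (n<2^n (suc b)) (ℕ.m≤m+n n (a ℕ.* n)))))))
  where
  n = 2 ℕ.^ suc b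
  lhs : + suc b ≡ + 1 ℤ.* (+ suc b ℤ.* + 1)
  lhs = sym (trans (ℤ.*-identityˡ _) (ℤ.*-identityʳ _))
  rhs : + (suc a ℕ.* n) ≡ (+ suc a ℤ.* + n) ℤ.* + 1
  rhs = trans (ℤ.pos-* (suc a) n) (sym (ℤ.*-identityʳ _))
2^-archimedean {mkℚ ℤ.-[1+ _ ]   b _} (*<* ())

-- Constructive reals

≤-pointwise : ∀ {x y} → (∀ n → seq x n ℚ.≤ seq y n) → x ≤ y
≤-pointwise {x} {y} h ε 0<ε = 0 , λ n _ → ℚ.≤-<-trans (h n)
  (subst (ℚ._< seq y n ℚ.+ ε) (ℚ.+-identityʳ (seq y n)) (ℚ.+-monoʳ-< (seq y n) 0<ε))

≡⇒≈ : ∀ {x y} → x ≡ y → x ≈ y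
≡⇒≈ {x} refl = ≈-refl {x}

<⇒≱ : ∀ {x y} → x < y → ¬ (y ≤ x)
<⇒≱ {x} {y} (ε , 0<ε , M , h) y≤x with y≤x ε 0<ε
... | N , k = ℚ.<-irrefl refl (ℚ.<-≤-trans
  (k (M ℕ.⊔ N) (ℕ.m≤n⊔m M N)) (h (M ℕ.⊔ N) (ℕ.m≤m⊔n M N)))

-- The cap at 1 keeps 2 - ε nonnegative once `y` is 2, so that inequalities may be multiplied by 2 -
-- ε.
<-gap≤1 : ∀ {x y} → x < y → ∃[ ε ] (0ℚ ℚ.< ε × ε ℚ.≤ 1ℚ ×
  ∃[ N ] (∀ n → N ℕ.≤ n → seq x n ℚ.+ ε ℚ.≤ seq y n))
<-gap≤1 {x} (ε , 0<ε , N , h) = ε ℚ.⊓ 1ℚ , 0<ε⊓1 , ℚ.p⊓q≤q ε 1ℚ ,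
  N , λ n N≤n → ℚ.≤-trans (ℚ.+-monoʳ-≤ (seq x n) (ℚ.p⊓q≤p ε 1ℚ)) (h n N≤n)
  where
  0<ε⊓1 : 0ℚ ℚ.< ε ℚ.⊓ 1ℚ
  0<ε⊓1 with ℚ.⊓-sel ε 1ℚ
  ... | inj₁ eq = subst (0ℚ ℚ.<_) (sym eq) 0<ε
  ... | inj₂ eq = subst (0ℚ ℚ.<_) (sym eq) (ℚ.positive⁻¹ 1ℚ)

module _ {A : Set} (_∙_ : ℝ → ℝ → ℝ) (P : ℝ → Set) (f : A → ℝ) where

  -- Together with `foldr₁-any` this covers all four bounds: lower bounds on a minimum and upper
  -- bounds on a maximum require every entry, while the two opposite bounds follow from a single
  -- entry.
  foldr₁-all : (∀ x y → P x → P y → P (x ∙ y)) → ∀ a as →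
    (∀ b → b ∈ₗ a ∷ as → P (f b)) → P (List⁺.foldr₁ _∙_ (List⁺.map f (a ∷ as)))
  foldr₁-all closed a []        all = all a (here refl)
  foldr₁-all closed a (a′ ∷ as) all = closed _ _ (all a (here refl))
    (foldr₁-all closed a′ as (λ b b∈ → all b (there b∈)))

  foldr₁-any : (∀ x y → P x ⊎ P y → P (x ∙ y)) → ∀ a as {b} →
    b ∈ₗ a ∷ as → P (f b) → P (List⁺.foldr₁ _∙_ (List⁺.map f (a ∷ as)))
  foldr₁-any absorb a []        (here refl) p = p
  foldr₁-any absorb a (a′ ∷ as) (here refl) p = absorb _ _ (inj₁ p)
  foldr₁-any absorb a (a′ ∷ as) (there b∈)  p =
    absorb _ _ (inj₂ (foldr₁-any absorb a′ as b∈ p))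

-- Bounds on cost and OPT, for each rational approximation separately

module _ (M : FiniteMetricSpace) (n : ℕ) where

  cost-lower : ∀ C (C≢∅ : Nonempty C) {v} x →
    (∀ c → c ∈ C → v ℚ.≤ seq (d M x c) n) → v ℚ.≤ seq (cost M C C≢∅) n
  cost-lower C (w , w∈C) {v} x far =
    foldr₁-any _⊔_ (λ r → v ℚ.≤ seq r n) _
      (λ { r s (inj₁ p) → ℚ.p≤q⇒p≤q⊔r (seq s n) p
         ; r s (inj₂ p) → ℚ.p≤q⇒p≤r⊔q (seq r n) p })
      w (allFin _) (there (∈-allFin x))
      (foldr₁-all _⊓_ (λ r → v ℚ.≤ seq r n) (d M x)
        (λ _ _ → ℚ.⊓-glb) w (elements C)
        -- The repeated head `w` is itself a center, so the hypothesis covers it too.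
        λ { c (here refl) → far c w∈C
          ; c (there c∈) → far c (proj₂ (∈-filter⁻ (_∈? C) {xs = allFin _} c∈)) })

  cost-upper : ∀ C (C≢∅ : Nonempty C) {u} →
    (∀ x → ∃[ c ] (c ∈ C × seq (d M x c) n ℚ.≤ u)) → seq (cost M C C≢∅) n ℚ.≤ u
  cost-upper C (w , w∈C) {u} near =
    foldr₁-all _⊔_ (λ r → seq r n ℚ.≤ u) _ (λ _ _ → ℚ.⊔-lub) w (allFin _)
      λ x _ → let (c , c∈C , close) = near x in
        foldr₁-any _⊓_ (λ r → seq r n ℚ.≤ u) (d M x)
          (λ { r s (inj₁ p) → ℚ.p≤q⇒p⊓r≤q (seq s n) p
             ; r s (inj₂ p) → ℚ.p≤q⇒r⊓p≤q (seq r n) p })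
          w (elements C) (there (∈-filter⁺ (_∈? C) (∈-allFin c) c∈C)) close

∈-subsets : ∀ {n k} (C : Subset n) (eq : ∣ C ∣ ≡ k) → (C , eq) ∈ₗ subsets n k
∈-subsets             []            refl = here refl
∈-subsets             (inside  ∷ C) refl = ∈-++⁺ˡ (∈-map⁺ _ (∈-subsets C refl))
∈-subsets {k = zero}  (outside ∷ C) eq   = ∈-map⁺ _ (∈-subsets C eq)
∈-subsets {k = suc k} (outside ∷ C) eq   = ∈-++⁺ʳ _ (∈-map⁺ _ (∈-subsets C eq))

module _ (M : FiniteMetricSpace) (n k : ℕ) (1≤k : 1 ℕ.≤ k) (k≤size : k ℕ.≤ size M) where

  private
    subsetCost : Σ[ C ∈ Subset (size M) ] ∣ C ∣ ≡ k → ℝ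
    subsetCost (C , eq) = cost M C (nonempty C eq 1≤k)

  OPT-lower : ∀ {v} → (∀ x y → v ℚ.≤ seq (d M x y) n) → v ℚ.≤ seq (OPT M k 1≤k k≤size) n
  OPT-lower {v} h =
    foldr₁-all _⊓_ (λ r → v ℚ.≤ seq r n) subsetCost (λ _ _ → ℚ.⊓-glb)
      (firstSubset k≤size) (subsets (size M) k)
      λ (C , eq) _ → let C≢∅ = nonempty C eq 1≤k in
        cost-lower M n C C≢∅ (proj₁ C≢∅) (λ c _ → h _ c)

  OPT-upper : ∀ {u} C → ∣ C ∣ ≡ k →
    (∀ x → ∃[ c ] (c ∈ C × seq (d M x c) n ℚ.≤ u)) → seq (OPT M k 1≤k k≤size) n ℚ.≤ u
  OPT-upper {u} C eq near =
    foldr₁-any _⊓_ (λ r → seq r n ℚ.≤ u) subsetCost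
      (λ { r s (inj₁ p) → ℚ.p≤q⇒p⊓r≤q (seq s n) p
         ; r s (inj₂ p) → ℚ.p≤q⇒r⊓p≤q (seq r n) p })
      (firstSubset k≤size) (subsets (size M) k)
      (there (∈-subsets C eq)) (cost-upper M n C (nonempty C eq 1≤k) near)

-- Finite subsets of the natural line

module _ {n} (p : Fin (suc n) → ℕ) (p-injective : Injective _≡_ _≡_ p) where

  lineMetric : FiniteMetricSpace
  lineMetric = record
    { size         = suc n
    ; d            = δ
    ; isSemiMetric = record
      { isQuasiSemiMetric = record
        { isPreMetric = record
          { isProtoMetric = record
            { isPartialOrder  = ≤-isPartialOrder
            ; ≈-isEquivalence = isEquivalence
            ; cong            = λ { {x} {_} {y} refl refl → ≈-refl {δ x y} }
            ; nonNegative     = λ {x} {y} → ≤-pointwise {0ℝ} {δ x y} (λ _ → ι-mono z≤n)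
            }
          ; ≈⇒0 = λ { {x} refl → ≡⇒≈ (cong (λ m → fromℚ (ι m)) (ℕ.∣n-n∣≡0 (p x))) }
          }
        ; 0⇒≈ = 0⇒≈
        }
      ; sym = λ x y → ≡⇒≈ (cong (λ m → fromℚ (ι m)) (ℕ.∣-∣-comm (p x) (p y)))
      }
    ; triangle = λ x y z → ≤-pointwise {δ x z} {δ x y + δ y z} (λ _ →
        subst (ι ℕ.∣ p x - p z ∣ ℚ.≤_) (ι-+ ℕ.∣ p x - p y ∣ ℕ.∣ p y - p z ∣)
          (ι-mono (ℕ.∣-∣-triangle (p x) (p y) (p z))))
    }
    where
    δ : Fin (suc n) → Fin (suc n) → ℝ
    δ i j = fromℚ (ι ℕ.∣ p i - p j ∣)

    0⇒≈ : ∀ {x y} → δ x y ≈ 0ℝ → x ≡ y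
    -- Distances are natural numbers, so being within 1 of zero already forces zero.
    0⇒≈ {x} {y} δ≈0 with ≈⇒≤ {δ x y} {0ℝ} δ≈0 1ℚ (ℚ.positive⁻¹ 1ℚ)
    ... | N , h = p-injective (ℕ.∣m-n∣≡0⇒m≡n (ℕ.n<1⇒n≡0 (ι-cancel-< (h N ℕ.≤-refl))))

  OPT-nonNegative : ∀ k 1≤k k≤n m → 0ℚ ℚ.≤ seq (OPT lineMetric k 1≤k k≤n) m
  OPT-nonNegative k 1≤k k≤n m = OPT-lower lineMetric m k 1≤k k≤n (λ _ _ → ι-mono z≤n)

-- The points 2^N, …, 2, 1, 0, in this order

coord : ℕ → ℕ → ℕ
coord N       zero    = 2 ℕ.^ N
coord zero    (suc t) = 0
coord (suc N) (suc t) = coord N t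

coord≤2^N : ∀ N t → coord N t ℕ.≤ 2 ℕ.^ N
coord≤2^N N       zero    = ℕ.≤-refl
coord≤2^N zero    (suc t) = z≤n
coord≤2^N (suc N) (suc t) = ℕ.≤-trans (coord≤2^N N t) (ℕ.m≤m+n _ _)

coord>0 : ∀ {N t} → t ℕ.≤ N → 0 ℕ.< coord N t
coord>0 {N}     {zero}  _         = ℕ.m^n>0 2 N
coord>0 {suc N} {suc t} (s≤s t≤N) = coord>0 t≤N

coord-last : ∀ N → coord N (suc N) ≡ 0
coord-last zero    = refl
coord-last (suc N) = coord-last N

coord≤1 : ∀ {N t} → N ℕ.≤ t → coord N t ℕ.≤ 1
coord≤1 {zero}  {zero}  _         = ℕ.≤-refl
coord≤1 {zero}  {suc t} _         = z≤n
coord≤1 {suc N} {suc t} (s≤s N≤t) = coord≤1 N≤t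

coord-halve : ∀ {N t} → t ℕ.< N → coord N t ≡ coord N (suc t) ℕ.+ coord N (suc t)
coord-halve {suc N} {zero}  _         = cong (2 ℕ.^ N ℕ.+_) (ℕ.+-identityʳ (2 ℕ.^ N))
coord-halve {suc N} {suc t} (s≤s t<N) = coord-halve t<N

-- Each value beyond index `l` is at most half the value at `l`. The indices `s` and `t` may
-- coincide, so monotonicity and injectivity follow as well as separation.
coord-sum : ∀ N {l s t} → l ℕ.< s → l ℕ.< t → coord N s ℕ.+ coord N t ℕ.≤ coord N l
coord-sum zero    {l}     {suc s} {suc t} _ _ = z≤n
coord-sum (suc N) {zero}  {suc s} {suc t} _ _ = ℕ.+-mono-≤ (coord≤2^N N s)
  (ℕ.≤-trans (coord≤2^N N t) (ℕ.m≤m+n _ 0))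
coord-sum (suc N) {suc l} {suc s} {suc t} (s≤s l<s) (s≤s l<t) = coord-sum N l<s l<t

coord-antitone : ∀ N {s t} → s ℕ.≤ t → coord N t ℕ.≤ coord N s
coord-antitone N {s} {t} s≤t with ℕ.m≤n⇒m<n∨m≡n s≤t
... | inj₁ s<t  = ℕ.≤-trans (ℕ.m≤m+n _ _) (coord-sum N s<t s<t)
... | inj₂ refl = ℕ.≤-refl

-- Equality would give 2a ≤ a for the common value a, which is positive because only the index N + 1
-- carries 0.
coord-≢ : ∀ N {s t} → s ℕ.≤ N → s ℕ.< t → coord N s ≢ coord N t
coord-≢ N {s} {t} s≤N s<t eq = ℕ.<⇒≱ (ℕ.m<m+n (coord N s) (coord>0 s≤N))
  (subst (λ m → m ℕ.+ m ℕ.≤ coord N s) (sym eq) (coord-sum N s<t s<t))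

point : ∀ N → Fin (suc (suc N)) → ℕ
point N t = coord N (toℕ t)

point-injective : ∀ N → Injective _≡_ _≡_ (point N)
point-injective N {s} {t} eq with ℕ.<-cmp (toℕ s) (toℕ t)
... | tri< s<t _ _ = contradiction eq
  (coord-≢ N (ℕ.≤-pred (ℕ.≤-trans s<t (Fin.toℕ≤pred[n] t))) s<t)
... | tri≈ _ s≡t _ = Fin.toℕ-injective s≡t
... | tri> _ _ t<s = contradiction (sym eq)
  (coord-≢ N (ℕ.≤-pred (ℕ.≤-trans t<s (Fin.toℕ≤pred[n] s))) t<s)

hardSpace : ℕ → FiniteMetricSpace
hardSpace N = lineMetric (point N) (point-injective N)

m+n≤o⇒m≤∣o-n∣ : ∀ {m n o} → m ℕ.+ n ℕ.≤ o → m ℕ.≤ ℕ.∣ o - n ∣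
m+n≤o⇒m≤∣o-n∣ {m} {n} {o} h = ℕ.≤-trans
  (ℕ.m+n≤o⇒m≤o∸n m h)
  (ℕ.m∸n≤∣m-n∣ o n)

-- Apply `coord-sum` at the smaller of `s` and `l`: the value there is at least the other one plus
-- the value at `t`. Hence omitting the point of index `l` costs at least the value at any later
-- index.
coord-separated : ∀ N {l s t} → l ℕ.< t → s ≢ l →
  coord N t ℕ.≤ ℕ.∣ coord N l - coord N s ∣
coord-separated N {l} {s} {t} l<t s≢l with ℕ.<-cmp s l
... | tri< s<l _ _ = subst (coord N t ℕ.≤_) (ℕ.∣-∣-comm (coord N s) (coord N l))
  (m+n≤o⇒m≤∣o-n∣ (coord-sum N (ℕ.<-trans s<l l<t) s<l))
... | tri≈ _ s≡l _ = contradiction s≡l s≢l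
... | tri> _ _ l<s = m+n≤o⇒m≤∣o-n∣ (coord-sum N l<t l<s)

-- The optimal centers at level t + 1: the indices 0, …, t − 1 and t + 1.
skip : ℕ → ∀ n → Subset n
skip zero    zero          = []
skip zero    (suc zero)    = outside ∷ []
skip zero    (suc (suc n)) = outside ∷ inside ∷ ⊥
skip (suc t) zero          = []
skip (suc t) (suc n)       = inside ∷ skip t n

∣skip∣ : ∀ {t n} → suc t ℕ.< n → ∣ skip t n ∣ ≡ suc t
∣skip∣ {zero}  {suc zero}    (s≤s ())
∣skip∣ {zero}  {suc (suc n)} _           = cong suc (∣⊥∣≡0 n)
∣skip∣ {suc t} {suc n}       (s≤s 1+t<n) = cong suc (∣skip∣ 1+t<n)

∈-skip-< : ∀ {t n} (x : Fin n) → toℕ x ℕ.< t → x ∈ skip t n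
∈-skip-< {suc t} zero    _         = here
∈-skip-< {suc t} (suc x) (s≤s x<t) = there (∈-skip-< x x<t)

∈-skip-suc : ∀ {t n} (x : Fin n) → toℕ x ≡ suc t → x ∈ skip t n
∈-skip-suc {zero}  {suc (suc n)} (suc zero) _  = there here
∈-skip-suc {suc t} {suc n}       (suc x)    eq = there (∈-skip-suc x (ℕ.suc-injective eq))

-- Points of index below `t` are their own centers. All others lie in the interval from 0 to 2b,
-- where b is the value of the center at index t + 1, hence within b of that center.
hardSpace-OPT : ∀ {N t} → t ℕ.< N → ∀ 1≤k k≤n m →
  seq (OPT (hardSpace N) (suc t) 1≤k k≤n) m ℚ.≤ ι (coord N (suc t))
hardSpace-OPT {N} {t} t<N 1≤k k≤n m =
  OPT-upper (hardSpace N) m (suc t) 1≤k k≤n (skip t _) (∣skip∣ 1+t<size) near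
  where
  1+t<size : suc t ℕ.< suc (suc N)
  1+t<size = s≤s (ℕ.<⇒≤ (s≤s t<N))

  next : Fin (suc (suc N))
  next = fromℕ< 1+t<size

  toℕ-next : toℕ next ≡ suc t
  toℕ-next = Fin.toℕ-fromℕ< 1+t<size

  near : ∀ x → ∃[ c ] (c ∈ skip t _ ×
    ι ℕ.∣ point N x - point N c ∣ ℚ.≤ ι (coord N (suc t)))
  near x with toℕ x ℕ.<? t
  ... | yes x<t = x , ∈-skip-< x x<t ,
    ι-mono (subst (ℕ._≤ _) (sym (ℕ.∣n-n∣≡0 (point N x))) z≤n)
  ... | no  x≮t = next , ∈-skip-suc next toℕ-next , ι-mono
    (subst (λ s → ℕ.∣ point N x - coord N s ∣ ℕ.≤ coord N (suc t)) (sym toℕ-next)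
      (ball (subst (point N x ℕ.≤_) (coord-halve t<N) (coord-antitone N (ℕ.≮⇒≥ x≮t)))))
    where
    ball : ∀ {a b} → a ℕ.≤ b ℕ.+ b → ℕ.∣ a - b ∣ ℕ.≤ b
    ball {a} {b} a≤2b with ℕ.≤-total a b
    ... | inj₁ a≤b = subst (ℕ._≤ b) (sym (ℕ.m≤n⇒∣m-n∣≡n∸m a≤b)) (ℕ.m∸n≤m b a)
    ... | inj₂ b≤a = subst (ℕ._≤ b) (sym (ℕ.m≤n⇒∣n-m∣≡n∸m b≤a))
      (ℕ.m≤n+o⇒m∸n≤o a b a≤2b)

-- Prefixes of an ordering

∈-prefix⁻ : ∀ {n} (σ : Permutation′ n) k x → x ∈ prefix σ k → toℕ (σ ⟨$⟩ˡ x) ℕ.< k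
∈-prefix⁻ σ k x x∈ = ℕ.<ᵇ⇒< _ k (Equivalence.from T-≡
  (trans (sym (lookup∘tabulate _ x)) ([]=⇒lookup x∈)))

-- Pigeonhole: a further member `s` with index at least `k` would give k + 1 distinct points
-- occupying only k positions of the ordering.
prefix-initial : ∀ {n} (σ : Permutation′ n) k → k ℕ.≤ n →
  (∀ l → toℕ l ℕ.< k → l ∈ prefix σ k) → ∀ s → s ∈ prefix σ k → toℕ s ℕ.< k
prefix-initial {n} σ k k≤n initial s s∈ with toℕ s ℕ.<? k
... | yes s<k = s<k
... | no  s≮k = contradiction (Fin.injective⇒≤ position-injective) (ℕ.<-irrefl refl)
  where
  member : Fin (suc k) → Fin n
  member zero    = s
  member (suc i) = inject≤ i k≤n

  inject<k : ∀ i → toℕ (inject≤ i k≤n) ℕ.< k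
  inject<k i = subst (ℕ._< k) (sym (Fin.toℕ-inject≤ i k≤n)) (Fin.toℕ<n i)

  position< : ∀ i → toℕ (σ ⟨$⟩ˡ member i) ℕ.< k
  position< zero    = ∈-prefix⁻ σ k s s∈
  position< (suc i) = ∈-prefix⁻ σ k _ (initial _ (inject<k i))

  position : Fin (suc k) → Fin k
  position i = fromℕ< (position< i)

  member-injective : ∀ i j → member i ≡ member j → i ≡ j
  member-injective zero    zero    _  = refl
  member-injective zero    (suc j) eq =
    contradiction (subst (λ r → toℕ r ℕ.< k) (sym eq) (inject<k j)) s≮k
  member-injective (suc i) zero    eq =
    contradiction (subst (λ r → toℕ r ℕ.< k) eq (inject<k i)) s≮k
  member-injective (suc i) (suc j) eq = cong suc (Fin.inject≤-injective k≤n k≤n i j eq)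

  position-injective : Injective _≡_ _≡_ position
  position-injective {i} {j} eq = member-injective i j
    (trans (sym (inverseʳ σ))
      (trans (cong (σ ⟨$⟩ʳ_) (Fin.toℕ-injective
        (trans (sym (Fin.toℕ-fromℕ< (position< i)))
          (trans (cong toℕ eq) (Fin.toℕ-fromℕ< (position< j))))))
        (inverseʳ σ)))

-- A point far from every prefix center

module _ (N : ℕ) (σ : Permutation′ (suc (suc N))) where

  first : Fin (suc (suc N))
  first = σ ⟨$⟩ʳ zero

  -- Let t be the index of the first center and consider t + 1 centers. Either some index below t is
  -- omitted, and that point is isolated by `coord-separated`, or the centers are exactly the
  -- indices 0, ..., t.
  far-from-prefix : ∃[ x ] (∀ c → c ∈ prefix σ (suc (toℕ first)) →
    coord N (toℕ first) ℕ.≤ ℕ.∣ point N x - point N c ∣)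
  far-from-prefix
    with Fin.any? (λ l → (toℕ l ℕ.<? toℕ first) ×-dec ¬? (l ∈? prefix σ (suc (toℕ first))))
  ... | yes (l , l<t , l∉) = l , λ c c∈ →
    coord-separated N l<t (λ c≡l → l∉ (subst (_∈ _) (Fin.toℕ-injective c≡l) c∈))
  -- The witness is the point 0, at the last index; its distance to a center is that center's value,
  -- which is smallest at index t.
  ... | no  none = fromℕ (suc N) , λ c c∈ →
    subst (λ z → coord N (toℕ first) ℕ.≤ ℕ.∣ z - point N c ∣)
      (sym (trans (cong (coord N) (Fin.toℕ-fromℕ (suc N))) (coord-last N)))
      (coord-antitone N (ℕ.≤-pred
        (prefix-initial σ _ (Fin.toℕ<n first) initial c c∈)))
    where
    initial : ∀ l → toℕ l ℕ.< suc (toℕ first) → l ∈ prefix σ (suc (toℕ first))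
    initial l (s≤s l≤t) with ℕ.m≤n⇒m<n∨m≡n l≤t | l ∈? prefix σ (suc (toℕ first))
    ... | _        | yes l∈ = l∈
    ... | inj₁ l<t | no  l∉ = contradiction (l , l<t , l∉) none
    -- Index t is the first center, so it lies in every nonempty prefix.
    ... | inj₂ l≡t | no  _  = subst (_∈ prefix σ (suc (toℕ first)))
      (sym (Fin.toℕ-injective l≡t)) (∈-prefix σ _ zero (s≤s z≤n))

  prefix-1 : ∀ c → c ∈ prefix σ 1 → c ≡ first
  prefix-1 c c∈ = trans (sym (inverseʳ σ)) (cong (σ ⟨$⟩ʳ_)
    (Fin.toℕ-injective (ℕ.n<1⇒n≡0 (∈-prefix⁻ σ 1 c c∈))))

c*x<y : ∀ {c ε} → ε ℚ.≤ 1ℚ → ∀ N₀ → (∀ n → N₀ ℕ.≤ n → seq c n ℚ.+ ε ℚ.≤ ι 2) →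
  ∀ x y u v → (∀ n → 0ℚ ℚ.≤ seq x n) → (∀ n → seq x n ℚ.≤ u) → (∀ n → v ℚ.≤ seq y n) →
  ι 2 ℚ.* u ℚ.< v ℚ.+ ε ℚ.* u → c * x < y

-- Strict inequality of reals from rational bounds

c*x<y {c} {ε} ε≤1 N₀ c+ε≤2 x y u v 0≤x x≤u v≤y 2u<v+εu =
  -- The gap is v - (2 - ε)u, the distance from the upper bound on `c * x` to the lower bound on
  -- `y`.
  (v ℚ.+ ε ℚ.* u) ℚ.- ι 2 ℚ.* u ,
  subst (ℚ._< (v ℚ.+ ε ℚ.* u) ℚ.- ι 2 ℚ.* u) (ℚ.+-inverseʳ (ι 2 ℚ.* u))
    (ℚ.+-monoˡ-< (ℚ.- (ι 2 ℚ.* u)) 2u<v+εu) ,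
  N₀ , bound
  where
  open +-*-Solver

  0≤2-ε : 0ℚ ℚ.≤ ι 2 ℚ.- ε
  0≤2-ε = ℚ.≤-trans (ι-mono z≤n) (ℚ.+-monoʳ-≤ (ι 2) (ℚ.neg-antimono-≤ ε≤1))

  c≤2-ε : ∀ n → N₀ ℕ.≤ n → seq c n ℚ.≤ ι 2 ℚ.- ε
  c≤2-ε n N₀≤n = subst (ℚ._≤ ι 2 ℚ.- ε)
    (solve 2 (λ c ε → c :+ ε :- ε := c) refl (seq c n) ε)
    (ℚ.+-monoˡ-≤ (ℚ.- ε) (c+ε≤2 n N₀≤n))

  bound : ∀ n → N₀ ℕ.≤ n →
    seq c n ℚ.* seq x n ℚ.+ ((v ℚ.+ ε ℚ.* u) ℚ.- ι 2 ℚ.* u) ℚ.≤ seq y n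
  bound n N₀≤n = ℚ.≤-trans
    (subst (seq c n ℚ.* seq x n ℚ.+ ((v ℚ.+ ε ℚ.* u) ℚ.- ι 2 ℚ.* u) ℚ.≤_)
      (solve 4 (λ t ε u v → (t :- ε) :* u :+ ((v :+ ε :* u) :- t :* u) := v) refl (ι 2) ε u v)
      (ℚ.+-monoˡ-≤ ((v ℚ.+ ε ℚ.* u) ℚ.- ι 2 ℚ.* u) (ℚ.≤-trans
        -- First c is replaced by 2 - ε using x ≥ 0, then x by u using 2 - ε ≥ 0; this order also
        -- handles negative c.
        (ℚ.*-monoʳ-≤-nonNeg (seq x n) {{ℚ.nonNegative (0≤x n)}} (c≤2-ε n N₀≤n))
        (ℚ.*-monoˡ-≤-nonNeg (ι 2 ℚ.- ε) {{ℚ.nonNegative 0≤2-ε}} (x≤u n)))))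
    (v≤y n)

-- The bad level of an ordering

Bad : (M : FiniteMetricSpace) → ℝ → Permutation′ (size M) → Set
Bad M c σ = Σ[ k ∈ ℕ ] Σ[ 1≤k ∈ 1 ℕ.≤ k ] Σ[ k≤n ∈ k ℕ.≤ size M ]
  c * OPT M k 1≤k k≤n < ALG M σ k 1≤k k≤n

2*ι : ∀ u → ι 2 ℚ.* ι u ≡ ι (u ℕ.+ u)
2*ι u = trans (solve 1 (λ u → con (ι 2) :* u := u :+ u) refl (ι u)) (sym (ι-+ u u))
  where open +-*-Solver

hardSpace-bad : ∀ {c ε} → 0ℚ ℚ.< ε → ε ℚ.≤ 1ℚ →
  ∀ N₀ → (∀ n → N₀ ℕ.≤ n → seq c n ℚ.+ ε ℚ.≤ ι 2) →
  ∀ K → 1ℚ ℚ.< ε ℚ.* ι (2 ℕ.^ K) → ∀ σ → Bad (hardSpace (suc K)) c σ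
hardSpace-bad {c} {ε} 0<ε ε≤1 N₀ c+ε≤2 K 1<ε2^K σ with toℕ (first (suc K) σ) ℕ.<? suc K
-- The first center is 2^j with j ≥ 1. Here ALG is at least 2u and OPT at most u, so any positive ε
-- gives a strict inequality.
... | yes t<N = suc t , s≤s z≤n , k≤n ,
  c*x<y {c} ε≤1 N₀ c+ε≤2
    (OPT M (suc t) (s≤s z≤n) k≤n)
    (ALG M σ (suc t) (s≤s z≤n) k≤n)
    (ι u) (ι (coord N t))
    (OPT-nonNegative (point N) (point-injective N) (suc t) (s≤s z≤n) k≤n)
    (hardSpace-OPT t<N (s≤s z≤n) k≤n)
    (λ n → let (x , far) = far-from-prefix N σ in
      cost-lower M n (prefix σ (suc t)) (prefix-nonempty σ (suc t) (s≤s z≤n) k≤n) x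
        (λ c c∈ → ι-mono (far c c∈)))
    (subst₂ ℚ._<_
      (trans (ℚ.+-identityʳ (ι (coord N t)))
        (trans (cong ι (coord-halve t<N)) (sym (2*ι u))))
      refl
      (ℚ.+-monoʳ-< (ι (coord N t))
        (subst (ℚ._< ε ℚ.* ι u) (ℚ.*-zeroʳ ε)
          (ℚ.*-monoʳ-<-pos ε {{ℚ.positive 0<ε}} 0<u))))
  where
  N = suc K
  M = hardSpace N
  t = toℕ (first N σ)
  u = coord N (suc t)
  k≤n = Fin.toℕ<n (first N σ)
  0<u : 0ℚ ℚ.< ι u
  0<u = ℚ.<-≤-trans (ℚ.positive⁻¹ 1ℚ) (ι-mono (coord>0 t<N))
-- The first center is 1 or 0, seen from the point 2^N at index `zero`. ALG is at least 2u - 1 with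
-- u = 2^K, and the missing 1 is made up by ε 2^K > 1.
... | no t≮N = 1 , s≤s z≤n , s≤s z≤n ,
  c*x<y {c} ε≤1 N₀ c+ε≤2
    (OPT M 1 (s≤s z≤n) (s≤s z≤n))
    (ALG M σ 1 (s≤s z≤n) (s≤s z≤n))
    (ι u) (ι v)
    (OPT-nonNegative (point N) (point-injective N) 1 (s≤s z≤n) (s≤s z≤n))
    (hardSpace-OPT {N} {0} (s≤s z≤n) (s≤s z≤n) (s≤s z≤n))
    (λ n → cost-lower M n (prefix σ 1) (prefix-nonempty σ 1 (s≤s z≤n) (s≤s z≤n)) zero
      (λ c c∈ → ι-mono (subst (λ c → v ℕ.≤ ℕ.∣ point N zero - point N c ∣)
        (sym (prefix-1 N σ c c∈)) v≤)))
    (subst (ℚ._< ι v ℚ.+ ε ℚ.* ι u)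
      (trans (sym (ι-+ v 1)) (trans (cong ι (trans (ℕ.m∸n+n≡m 1≤2^N) 2^N≡u+u)) (sym (2*ι u))))
      (ℚ.+-monoʳ-< (ι v) 1<ε2^K))
  where
  N = suc K
  M = hardSpace N
  u = 2 ℕ.^ K
  v = 2 ℕ.^ N ℕ.∸ 1
  1≤2^N = ℕ.m^n>0 2 N
  2^N≡u+u = coord-halve {N} {0} (s≤s z≤n)
  v≤ : v ℕ.≤ ℕ.∣ 2 ℕ.^ N - point N (first N σ) ∣
  v≤ = m+n≤o⇒m≤∣o-n∣ (ℕ.≤-trans (ℕ.+-monoʳ-≤ v (coord≤1 (ℕ.≮⇒≥ t≮N)))
    (ℕ.≤-reflexive (ℕ.m∸n+n≡m 1≤2^N)))

-- The gap below 2 fixes ε, and ε fixes K and thereby the space, so a single space defeats all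
-- orderings.
hardInstance : (c : ℝ) → c < 2ℝ → Σ[ M ∈ FiniteMetricSpace ] (∀ σ → Bad M c σ)
hardInstance c c<2 with <-gap≤1 {c} {2ℝ} c<2
... | ε , 0<ε , ε≤1 , N₀ , c+ε≤2 with 2^-archimedean 0<ε
... | K , 1<ε2^K = hardSpace (suc K) , hardSpace-bad {c} 0<ε ε≤1 N₀ c+ε≤2 K 1<ε2^K

theorem1p1 : ((A : IncrementalAlgorithm) (c : ℝ) → c < 2ℝ → ¬ RatioAtMost A c)
    ×
    ((c : ℝ) → c < 2ℝ →
    Σ[ M ∈ FiniteMetricSpace ]
    ((σ : Permutation′ (size M)) →
    Σ[ k ∈ ℕ ] Σ[ 1≤k ∈ 1 ℕ.≤ k ] Σ[ k≤n ∈ k ℕ.≤ size M ]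
    c * OPT M k 1≤k k≤n < ALG M σ k 1≤k k≤n))
theorem1p1 = noAlgorithm , hardInstance
  where
  noAlgorithm : (A : IncrementalAlgorithm) (c : ℝ) → c < 2ℝ → ¬ RatioAtMost A c
  noAlgorithm A c c<2 ratio≤c with hardInstance c c<2
  ... | M , bad with bad (A M)
  ... | k , 1≤k , k≤n , lt =
    <⇒≱ {c * OPT M k 1≤k k≤n} {ALG M (A M) k 1≤k k≤n} lt (ratio≤c M k 1≤k k≤n)
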